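{- Let $k\geq 1$ be an integer and let $q=2^{k-1}$. For every $r\geq 9$ there is an $r$-robust strategy for searching on the line with $k$-bit advice that has consistency at most $$1+2\,\frac{b_r^{1/q}}{b_r-1}.$$
   Context: The line is viewed as two unbounded rays, indexed $0$ and $1$, with common endpoint $O$ (the origin). A (single-searcher) search strategy is an infinite sequence $X=(x_i,u_i)_i$ with $x_i\in\mathbb{R}^+$ and $u_i\in\{0,1\}$: in iteration $i$ a unit-speed searcher starts from $O$, walks on ray $u_i$ up to distance $x_i$ from $O$, returns to $O$, and continues with iteration $i+1$, until the target is located. For a target $t$, $d(t)$ is its distance from $O$, and $d(X,t)$ is the total distance walked until the searcher first reaches $t$ (so $d(X,t)=d(t)+2\sum_{j<i}x_j$, where $i$ is the first iteration reaching $t$; $d(X,t)=\infty$ if $t$ is never reached). Standing assumption: targets are at distance at least some fixed constant $d_0>0$ from $O$. The competitive ratio of $X$ is $\sup_t d(X,t)/d(t)$. A strategy with $k$-bit (untrusted) advice consists of an assignment of a correct advice string $A(t)\in\{0,1\}^k$ to each target $t$ (the correct answers to $k$ binary queries about $t$), together with a search strategy $X_h$ for every $h\in\{0,1\}^k$, followed by the searcher when the given advice is $h$. Its consistency is its competitive ratio with error-free advice, $\sup_t d(X_{A(t)},t)/d(t)$. Its robustness is its competitive ratio with adversarial advice, $\sup_t\max_h d(X_h,t)/d(t)$. It is $r$-robust if its robustness is at most $r$. For $r\ge 9$, let $\rho_r=(r-1)/2$ and let $b_r$ be the largest real root of $\frac{x^2}{x-1}-\rho_r=0$ (equivalently, the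 largest $b>1$ for which the geometric strategy $x_i=b^i$, alternating between the two rays, has competitive ratio $1+2b^2/(b-1)\le r$). -}

module Defs where

open import Algebra.Bundles using (CommutativeRing; Semiring)
import Algebra.Construct.NaturalChoice.Max as NaturalMax
open import Algebra.Definitions using (Invertible)
import Algebra.Definitions.RawSemiring as RawSemiringDefinitions
import Algebra.Properties.Ring as RingProperties
open import Axiom.ExcludedMiddle using (ExcludedMiddle)
open import Data.Bool.Base using (Bool; true; false)
open import Data.Fin.Base using (Fin; toℕ)
open import Data.Nat.Base as ℕ using (ℕ; zero; suc)
open import Data.Product.Base using (Σ-syntax; ∃; ∃-syntax; _×_; _,_; proj₁; proj₂)
open import Data.Sum.Base using (inj₁; inj₂)
open import Data.Vec.Base using (Vec; []; _∷_)
open import Level using (0ℓ)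
open import Relation.Binary.Bundles using (TotalOrder)
open import Relation.Binary.Construct.Add.Supremum.NonStrict using (≤⁺-isTotalOrder)
open import Relation.Binary.Core using (Rel; _Preserves_⟶_)
open import Relation.Binary.PropositionalEquality.Core using (_≡_)
open import Relation.Binary.Structures using (IsTotalOrder)
open import Relation.Nullary.Construct.Add.Supremum using (_⁺; ⊤⁺; [_])
open import Relation.Nullary.Decidable.Core using (yes; no)
open import Relation.Nullary.Negation.Core using (¬_)

-- The standard library has no real numbers.  They are axiomatised as a
-- Dedekind-complete totally ordered field, which classically determines them
-- up to unique isomorphism.

record CompleteOrderedField : Set₁ where
  field
    commutativeRing : CommutativeRing 0ℓ 0ℓ

  open CommutativeRing commutativeRing public
  open RawSemiringDefinitions (Semiring.rawSemiring semiring) public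
    using (_^_; sum) renaming (_×_ to infixr 8 _·_)

  infix 4 _≤_ _<_
  infixl 7 _/_⟨_⟩

  field
    _≤_          : Rel Carrier 0ℓ
    isTotalOrder : IsTotalOrder _≈_ _≤_
    +-monoˡ-≤    : ∀ z → (_+ z) Preserves _≤_ ⟶ _≤_
    *-nonNeg     : ∀ {x y} → 0# ≤ x → 0# ≤ y → 0# ≤ x * y
    0≉1          : 0# ≉ 1#
    invertible   : ∀ {x} → x ≉ 0# → Invertible _≈_ 1# _*_ x

  UpperBound : (Carrier → Set) → Carrier → Set
  UpperBound P u = ∀ x → P x → x ≤ u

  LeastUpperBound : (Carrier → Set) → Carrier → Set
  LeastUpperBound P s = UpperBound P s × (∀ u → UpperBound P u → s ≤ u)

  field
    complete : (P : Carrier → Set) → ∃ P → ∃ (UpperBound P) → ∃ (LeastUpperBound P)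

  module ≤ = IsTotalOrder isTotalOrder

  _<_ : Rel Carrier 0ℓ
  x < y = x ≤ y × x ≉ y

  _/_⟨_⟩ : (x y : Carrier) → y ≉ 0# → Carrier
  x / y ⟨ y≉0 ⟩ = x * proj₁ (invertible y≉0)

  private
    open RingProperties (CommutativeRing.ring commutativeRing)
      using (-1*x≈-x; -‿involutive)

    x≤0⇒0≤-x : ∀ {x} → x ≤ 0# → 0# ≤ - x
    x≤0⇒0≤-x {x} x≤0 =
      ≤.≤-respˡ-≈ (-‿inverseʳ x) (≤.≤-respʳ-≈ (+-identityˡ (- x)) (+-monoˡ-≤ (- x) x≤0))

    0≤1 : 0# ≤ 1#
    0≤1 with ≤.total 0# 1#
    ... | inj₁ 0≤1 = 0≤1
    ... | inj₂ 1≤0 =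
      ≤.≤-respʳ-≈ (trans (-1*x≈-x (- 1#)) (-‿involutive 1#))
        (*-nonNeg (x≤0⇒0≤-x 1≤0) (x≤0⇒0≤-x 1≤0))

    1≤2 : 1# ≤ 2 · 1#
    1≤2 = ≤.≤-respˡ-≈ (+-identityˡ 1#)
      (≤.≤-respʳ-≈ (+-congˡ (sym (+-identityʳ 1#))) (+-monoˡ-≤ 1# 0≤1))

  2≉0 : 2 · 1# ≉ 0#
  2≉0 2≈0 = 0≉1 (≤.antisym 0≤1 (≤.≤-respʳ-≈ 2≈0 1≤2))

  <≤⇒≉0 : ∀ {x y} → 0# < x → x ≤ y → y ≉ 0#
  <≤⇒≉0 (0≤x , 0≉x) x≤y y≈0 = 0≉x (≤.antisym 0≤x (≤.≤-respʳ-≈ y≈0 x≤y))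

  ρ : Carrier → Carrier
  ρ r = (r - 1#) / 2 · 1# ⟨ 2≉0 ⟩

  -- x is a real root of x² / (x - 1) - ρ r; in particular x ≠ 1.
  IsRoot : Carrier → Carrier → Set
  IsRoot r x = Σ[ x-1≉0 ∈ x - 1# ≉ 0# ] (x * x / (x - 1#) ⟨ x-1≉0 ⟩ - ρ r ≈ 0#)

  -- b = b_r.
  IsLargestRoot : Carrier → Carrier → Set
  IsLargestRoot r b = IsRoot r b × (∀ x → IsRoot r x → x ≤ b)

  -- c = a^(1/n).
  IsNthRoot : ℕ → Carrier → Carrier → Set
  IsNthRoot n a c = 0# ≤ c × c ^ n ≈ a

-- Excluded middle makes the cost function total: whether a strategy ever
-- reaches a given target is undecidable.

module LineSearch (lem : ExcludedMiddle 0ℓ) (ℝ : CompleteOrderedField) where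

  open CompleteOrderedField ℝ

  ℝ⁺-totalOrder : TotalOrder 0ℓ 0ℓ 0ℓ
  ℝ⁺-totalOrder = record { isTotalOrder = ≤⁺-isTotalOrder _≤_ isTotalOrder }

  open TotalOrder ℝ⁺-totalOrder public using () renaming (_≤_ to infix 4 _≤⁺_)
  open NaturalMax ℝ⁺-totalOrder public using (_⊔_)

  IsSup : {I : Set} → (I → Carrier ⁺) → Carrier ⁺ → Set
  IsSup f s = (∀ i → f i ≤⁺ s) × (∀ u → (∀ i → f i ≤⁺ u) → s ≤⁺ u)

  maxBits : ∀ {k} → (Vec Bool k → Carrier ⁺) → Carrier ⁺
  maxBits {zero}  f = f []
  maxBits {suc k} f = maxBits (λ h → f (false ∷ h)) ⊔ maxBits (λ h → f (true ∷ h))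

  record Strategy : Set where
    field
      turn   : ℕ → Carrier
      turn>0 : ∀ i → 0# < turn i
      ray    : ℕ → Fin 2

  module Search (d₀ : Carrier) (d₀>0 : 0# < d₀) where

    record Target : Set where
      field
        ray     : Fin 2
        dist    : Carrier
        d₀≤dist : d₀ ≤ dist

      dist≉0 : dist ≉ 0#
      dist≉0 = <≤⇒≉0 d₀>0 d₀≤dist

    infix 4 _≈ᵗ_
    _≈ᵗ_ : Rel Target 0ℓ
    t ≈ᵗ t′ = Target.ray t ≡ Target.ray t′ × Target.dist t ≈ Target.dist t′

    Reaches : Strategy → Target → ℕ → Set
    Reaches X t i = Strategy.ray X i ≡ Target.ray t × Target.dist t ≤ Strategy.turn X i

    FirstReaches : Strategy → Target → ℕ → Set
    FirstReaches X t i = Reaches X t i × (∀ j → j ℕ.< i → ¬ Reaches X t j)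

    cost : Strategy → Target → Carrier ⁺
    cost X t with lem {∃ (FirstReaches X t)}
    ... | yes (i , _) = [ Target.dist t + 2 · sum {i} (λ j → Strategy.turn X (toℕ j)) ]
    ... | no  _       = ⊤⁺

    ratio : Strategy → Target → Carrier ⁺
    ratio X t with cost X t
    ... | [ c ] = [ c / Target.dist t ⟨ Target.dist≉0 t ⟩ ]
    ... | ⊤⁺    = ⊤⁺

    record AdviceStrategy (k : ℕ) : Set where
      field
        advice      : Target → Vec Bool k
        advice-cong : ∀ {t t′} → t ≈ᵗ t′ → advice t ≡ advice t′
        strategy    : Vec Bool k → Strategy

    module _ {k} (S : AdviceStrategy k) where

      open AdviceStrategy S

      IsConsistency : Carrier ⁺ → Set
      IsConsistency = IsSup (λ t → ratio (strategy (advice t)) t)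

      IsRobustness : Carrier ⁺ → Set
      IsRobustness = IsSup (λ t → maxBits (λ h → ratio (strategy h) t))

      ConsistencyAtMost : Carrier → Set
      ConsistencyAtMost c = ∃[ s ] (IsConsistency s × s ≤⁺ [ c ])

      Robust : Carrier → Set
      Robust r = ∃[ s ] (IsRobustness s × s ≤⁺ [ r ])

{-# OPTIONS --safe #-}

-- Let q = 2 ^ m with m = k − 1 and c = b ^ (1/q).  The 2q advised strategies are
-- the geometric ones with turning points d₀ cʲ bⁱ, 0 ≤ j < q, alternating
-- between the rays from either of them.  Together they turn at d₀ cⁿ on each ray
-- for every n.  A target at distance d gets the strategy whose turning point is
-- the first d₀ cⁿ ≥ d; then d₀ cⁿ ≤ c d.  Since (b − 1) Σ_{j<i} xⱼ ≤ xᵢ, a bound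
-- xᵢ ≤ M (b − 1) d on the turning point that finds the target makes the ratio at
-- most 1 + 2 M, which gives the consistency with M = c / (b − 1).  In every one of
-- these strategies xᵢ ≤ b² d, because either xᵢ₋₂ < d, or i ≤ 1 and cʲ ≤ b and
-- d₀ ≤ d, so that b² = ρ (b − 1) gives robustness 1 + 2 ρ = r.
module Submission where

open import Defs
import Algebra.Construct.NaturalChoice.Max as NaturalMax
import Algebra.Properties.Group as GroupProperties
import Algebra.Properties.Semiring.Exp as Exponentiation
import Algebra.Solver.Ring.NaturalCoefficients.Default as SemiringSolver
open import Axiom.ExcludedMiddle using (ExcludedMiddle)
open import Data.Bool.Base using (Bool; true; false; not)
open import Data.Bool.Properties using (not-involutive)
open import Data.Fin.Base using (Fin; toℕ)
open import Data.Nat.Base as ℕ using (ℕ; zero; suc)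
import Data.Nat.Properties as ℕₚ
open import Data.Product.Base using (Σ-syntax; ∃; ∃-syntax; _×_; _,_; proj₁; proj₂)
open import Data.Sum.Base using (_⊎_; inj₁; inj₂)
open import Data.Vec.Base using (Vec; []; _∷_)
open import Function.Base using (case_of_)
open import Level using (0ℓ)
open import Relation.Binary.Bundles using (TotalOrder)
open import Relation.Binary.Construct.Add.Supremum.NonStrict using ([_]; _≤⊤⁺; [≤]-injective)
import Relation.Binary.Properties.TotalOrder as TotalOrderProperties
open import Relation.Binary.PropositionalEquality.Core as ≡ using (_≡_)
open import Relation.Binary.PropositionalEquality.Properties using (module ≡-Reasoning)
import Relation.Binary.Reasoning.PartialOrder as PartialOrderReasoning
open import Relation.Nullary.Construct.Add.Supremum using (_⁺; ⊤⁺; [_])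
open import Relation.Nullary.Decidable.Core using (yes; no)
open import Relation.Nullary.Negation.Core using (¬_; contradiction)

-- Arithmetic of inequalities in an ordered field.

module OrderedField (ℝ : CompleteOrderedField) where

  open CompleteOrderedField ℝ

  totalOrder : TotalOrder 0ℓ 0ℓ 0ℓ
  totalOrder = record { isTotalOrder = isTotalOrder }

  open TotalOrder totalOrder public using (poset)
  open TotalOrderProperties totalOrder public
    using (≰⇒>; <⇒≱; <-irrefl)
  open PartialOrderReasoning poset
  open GroupProperties +-group using (∙-cancelʳ; //-rightDividesˡ; x∙y⁻¹≈ε⇒x≈y)
    renaming (//-rightDividesʳ to x+y-y≈x)
  open SemiringSolver commutativeSemiring using (solve; con; _:=_; _:+_; _:*_)

  abstract

    +-monoʳ-≤ : ∀ z {x y} → x ≤ y → z + x ≤ z + y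
    +-monoʳ-≤ z {x} {y} x≤y = begin
      z + x  ≈⟨ +-comm z x ⟩
      x + z  ≤⟨ +-monoˡ-≤ z x≤y ⟩
      y + z  ≈⟨ +-comm y z ⟩
      z + y  ∎

    +-mono-≤ : ∀ {x y u v} → x ≤ y → u ≤ v → x + u ≤ y + v
    +-mono-≤ {y = y} {u} x≤y u≤v = ≤.trans (+-monoˡ-≤ u x≤y) (+-monoʳ-≤ y u≤v)

    +-cancelʳ-≤ : ∀ z {x y} → x + z ≤ y + z → x ≤ y
    +-cancelʳ-≤ z {x} {y} x+z≤y+z = begin
      x            ≈⟨ x+y-y≈x z x ⟨
      x + z - z    ≤⟨ +-monoˡ-≤ (- z) x+z≤y+z ⟩
      y + z - z    ≈⟨ x+y-y≈x z y ⟩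
      y            ∎

    x≤x+y : ∀ {x y} → 0# ≤ y → x ≤ x + y
    x≤x+y {x} {y} 0≤y = begin
      x       ≈⟨ +-identityʳ x ⟨
      x + 0#  ≤⟨ +-monoʳ-≤ x 0≤y ⟩
      x + y   ∎

    0<y-x : ∀ {x y} → x < y → 0# < y - x
    0<y-x {x} {y} (x≤y , x≉y) = (begin
      0#     ≈⟨ -‿inverseʳ x ⟨
      x - x  ≤⟨ +-monoˡ-≤ (- x) x≤y ⟩
      y - x  ∎) , λ 0≈y-x → x≉y (sym (x∙y⁻¹≈ε⇒x≈y y x (sym 0≈y-x)))

    x<x+y : ∀ {x y} → 0# < y → x < x + y
    x<x+y {x} {y} (0≤y , 0≉y) = x≤x+y 0≤y , λ x≈x+y → 0≉y (∙-cancelʳ x 0# y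
      (trans (+-identityˡ x) (trans x≈x+y (+-comm x y))))

    -- Turns an inequality into an equation free of subtraction, which the semiring solver can then
    -- use.
    ≤⇒∃+ : ∀ {x y} → x ≤ y → ∃[ d ] (0# ≤ d × y ≈ x + d)
    ≤⇒∃+ {x} {y} x≤y = y - x
      , (begin 0# ≈⟨ -‿inverseʳ x ⟨ x - x ≤⟨ +-monoˡ-≤ (- x) x≤y ⟩ y - x ∎)
      , trans (sym (//-rightDividesˡ x y)) (+-comm (y - x) x)

    <⇒∃+ : ∀ {x y} → x < y → ∃[ d ] (0# < d × y ≈ x + d)
    <⇒∃+ {x} (x≤y , x≉y) with d , 0≤d , y≈x+d ← ≤⇒∃+ x≤y =
      d , (0≤d , λ 0≈d → x≉y (sym (trans y≈x+d (trans (+-congˡ (sym 0≈d)) (+-identityʳ x))))) , y≈x+d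

    *-monoʳ-≤ : ∀ {z} → 0# ≤ z → ∀ {x y} → x ≤ y → z * x ≤ z * y
    *-monoʳ-≤ {z} 0≤z {x} {y} x≤y with d , 0≤d , y≈x+d ← ≤⇒∃+ x≤y = begin
      z * x          ≤⟨ x≤x+y (*-nonNeg 0≤z 0≤d) ⟩
      z * x + z * d  ≈⟨ distribˡ z x d ⟨
      z * (x + d)    ≈⟨ *-congˡ y≈x+d ⟨
      z * y          ∎

    *-monoˡ-≤ : ∀ {z} → 0# ≤ z → ∀ {x y} → x ≤ y → x * z ≤ y * z
    *-monoˡ-≤ {z} 0≤z {x} {y} x≤y = begin
      x * z  ≈⟨ *-comm x z ⟩
      z * x  ≤⟨ *-monoʳ-≤ 0≤z x≤y ⟩
      z * y  ≈⟨ *-comm z y ⟩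
      y * z  ∎

    *-mono-≤ : ∀ {x y u v} → 0# ≤ u → 0# ≤ y → x ≤ y → u ≤ v → x * u ≤ y * v
    *-mono-≤ 0≤u 0≤y x≤y u≤v = ≤.trans (*-monoˡ-≤ 0≤u x≤y) (*-monoʳ-≤ 0≤y u≤v)

    x/y*y≈x : ∀ x {y} (y≉0 : y ≉ 0#) → x / y ⟨ y≉0 ⟩ * y ≈ x
    x/y*y≈x x {y} y≉0 with y⁻¹ , y⁻¹y≈1 , _ ← invertible y≉0 =
      trans (*-assoc x y⁻¹ y) (trans (*-congˡ y⁻¹y≈1) (*-identityʳ x))

    x*y/y≈x : ∀ x {y} (y≉0 : y ≉ 0#) → (x * y) / y ⟨ y≉0 ⟩ ≈ x
    x*y/y≈x x {y} y≉0 with y⁻¹ , _ , yy⁻¹≈1 ← invertible y≉0 =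
      trans (*-assoc x y y⁻¹) (trans (*-congˡ yy⁻¹≈1) (*-identityʳ x))

    *-cancelʳ-≈ : ∀ {x y z} → z ≉ 0# → x * z ≈ y * z → x ≈ y
    *-cancelʳ-≈ {x} {y} z≉0 xz≈yz =
      trans (sym (x*y/y≈x x z≉0)) (trans (*-congʳ xz≈yz) (x*y/y≈x y z≉0))

    >⇒≉0 : ∀ {x} → 0# < x → x ≉ 0#
    >⇒≉0 (_ , 0≉x) x≈0 = 0≉x (sym x≈0)

    *-pos : ∀ {x y} → 0# < x → 0# < y → 0# < x * y
    *-pos {x} {y} (0≤x , 0≉x) 0<y = *-nonNeg 0≤x (proj₁ 0<y) ,
      λ 0≈xy → 0≉x (*-cancelʳ-≈ (>⇒≉0 0<y) (trans (zeroˡ y) 0≈xy))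

    +-nonNeg : ∀ {x y} → 0# ≤ x → 0# ≤ y → 0# ≤ x + y
    +-nonNeg 0≤x 0≤y = ≤.trans 0≤x (x≤x+y 0≤y)

    +-pos : ∀ {x y} → 0# < x → 0# ≤ y → 0# < x + y
    +-pos {x} {y} 0<x 0≤y = begin-strict
      0#      <⟨ 0<x ⟩
      x       ≤⟨ x≤x+y 0≤y ⟩
      x + y   ∎

    *-cancelʳ-≤ : ∀ {x y z} → 0# < z → x * z ≤ y * z → x ≤ y
    *-cancelʳ-≤ {x} {y} {z} 0<z xz≤yz with ≤.total x y
    ... | inj₁ x≤y = x≤y
    ... | inj₂ y≤x = ≤.reflexive (*-cancelʳ-≈ (>⇒≉0 0<z)
      (≤.antisym xz≤yz (*-monoˡ-≤ (proj₁ 0<z) y≤x)))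

    x/y≤z : ∀ {x y z} (y≉0 : y ≉ 0#) → 0# < y → x ≤ z * y → x / y ⟨ y≉0 ⟩ ≤ z
    x/y≤z {x} {y} {z} y≉0 0<y x≤zy = *-cancelʳ-≤ 0<y (begin
      x / y ⟨ y≉0 ⟩ * y  ≈⟨ x/y*y≈x x y≉0 ⟩
      x                  ≤⟨ x≤zy ⟩
      z * y              ∎)

    /-nonNeg : ∀ {x y} (y≉0 : y ≉ 0#) → 0# < y → 0# ≤ x → 0# ≤ x / y ⟨ y≉0 ⟩
    /-nonNeg {x} {y} y≉0 0<y 0≤x = *-cancelʳ-≤ 0<y (begin
      0# * y             ≈⟨ zeroˡ y ⟩
      0#                 ≤⟨ 0≤x ⟩
      x                  ≈⟨ x/y*y≈x x y≉0 ⟨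
      x / y ⟨ y≉0 ⟩ * y  ∎)

    /-pos : ∀ {x y} (y≉0 : y ≉ 0#) → 0# < y → 0# < x → 0# < x / y ⟨ y≉0 ⟩
    /-pos {x} {y} y≉0 0<y (0≤x , 0≉x) = /-nonNeg y≉0 0<y 0≤x ,
      λ 0≈x/y → 0≉x (trans (sym (zeroˡ y)) (trans (*-congʳ 0≈x/y) (x/y*y≈x x y≉0)))

    divide-pos : ∀ {x y} → 0# < x → 0# < y → ∃[ z ] (z * y ≈ x × 0# < z)
    divide-pos {x} {y} 0<x 0<y = x / y ⟨ >⇒≉0 0<y ⟩ , x/y*y≈x x (>⇒≉0 0<y) , /-pos (>⇒≉0 0<y) 0<y 0<x

    divide-nonNeg : ∀ {x y} → 0# ≤ x → 0# < y → ∃[ z ] (z * y ≈ x × 0# ≤ z)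
    divide-nonNeg {x} {y} 0≤x 0<y = x / y ⟨ >⇒≉0 0<y ⟩ , x/y*y≈x x (>⇒≉0 0<y) , /-nonNeg (>⇒≉0 0<y) 0<y 0≤x

    0≤1 : 0# ≤ 1#
    0≤1 with ≤.total 0# 1#
    ... | inj₁ 0≤1 = 0≤1
    -- Here `d` is -1, so 1 = `d * d` is a product of nonnegative factors.
    ... | inj₂ 1≤0 with d , 0≤d , 0≈1+d ← ≤⇒∃+ 1≤0 = begin
      0#               ≤⟨ *-nonNeg 0≤d 0≤d ⟩
      d * d            ≈⟨ +-identityʳ (d * d) ⟨
      d * d + 0#       ≈⟨ +-congˡ 0≈1+d ⟩
      d * d + (1# + d) ≈⟨ solve 1 (λ d → d :* d :+ (con 1 :+ d) := (con 1 :+ d) :* d :+ con 1) refl d ⟩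
      (1# + d) * d + 1# ≈⟨ +-congʳ (*-congʳ 0≈1+d) ⟨
      0# * d + 1#      ≈⟨ +-congʳ (zeroˡ d) ⟩
      0# + 1#          ≈⟨ +-identityˡ 1# ⟩
      1#               ∎

    0<1 : 0# < 1#
    0<1 = 0≤1 , 0≉1

    1<x⇒0<x : ∀ {x} → 1# < x → 0# < x
    1<x⇒0<x {x} 1<x = begin-strict 0# <⟨ 0<1 ⟩ 1# <⟨ 1<x ⟩ x ∎

    n·1-nonNeg : ∀ n → 0# ≤ n · 1#
    n·1-nonNeg zero    = ≤.refl
    n·1-nonNeg (suc n) = +-nonNeg 0≤1 (n·1-nonNeg n)

    n·1-pos : ∀ n → 0# < suc n · 1#
    n·1-pos n = +-pos 0<1 (n·1-nonNeg n)

    ^-nonNeg : ∀ {x} → 0# ≤ x → ∀ n → 0# ≤ x ^ n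
    ^-nonNeg 0≤x zero    = 0≤1
    ^-nonNeg 0≤x (suc n) = *-nonNeg 0≤x (^-nonNeg 0≤x n)

    ^-pos : ∀ {x} → 0# < x → ∀ n → 0# < x ^ n
    ^-pos 0<x zero    = 0<1
    ^-pos 0<x (suc n) = *-pos 0<x (^-pos 0<x n)

    x≤1⇒x^n≤1 : ∀ {x} → 0# ≤ x → x ≤ 1# → ∀ n → x ^ n ≤ 1#
    x≤1⇒x^n≤1 0≤x x≤1 zero    = ≤.refl
    x≤1⇒x^n≤1 {x} 0≤x x≤1 (suc n) = begin
      x * x ^ n  ≤⟨ *-mono-≤ (^-nonNeg 0≤x n) 0≤1 x≤1 (x≤1⇒x^n≤1 0≤x x≤1 n) ⟩
      1# * 1#    ≈⟨ *-identityˡ 1# ⟩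
      1#         ∎

    x^n≤x^[1+n] : ∀ {x} → 1# ≤ x → ∀ n → x ^ n ≤ x ^ suc n
    x^n≤x^[1+n] {x} 1≤x n = begin
      x ^ n       ≈⟨ *-identityˡ (x ^ n) ⟨
      1# * x ^ n  ≤⟨ *-monoˡ-≤ (^-nonNeg (≤.trans 0≤1 1≤x) n) 1≤x ⟩
      x * x ^ n   ∎

    ^-monoʳ-≤ : ∀ {x} → 1# ≤ x → ∀ {m n} → m ℕ.≤ n → x ^ m ≤ x ^ n
    ^-monoʳ-≤ 1≤x {n = zero}  ℕ.z≤n = ≤.refl
    ^-monoʳ-≤ 1≤x {n = suc n} ℕ.z≤n = ≤.trans (^-monoʳ-≤ 1≤x {n = n} ℕ.z≤n) (x^n≤x^[1+n] 1≤x n)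
    ^-monoʳ-≤ 1≤x (ℕ.s≤s m≤n) = *-monoʳ-≤ (≤.trans 0≤1 1≤x) (^-monoʳ-≤ 1≤x m≤n)

-- Perturbing a number whose square misses a given value.

module Squares (lem : ExcludedMiddle 0ℓ) (ℝ : CompleteOrderedField) where

  open CompleteOrderedField ℝ
  open OrderedField ℝ
  open PartialOrderReasoning poset
  open SemiringSolver commutativeSemiring using (solve; con; _:=_; _:+_; _:*_)

  abstract

    ≮∧≯⇒≈ : ∀ {x y} → ¬ x < y → ¬ y < x → x ≈ y
    ≮∧≯⇒≈ {x} {y} x≮y y≮x with lem {x ≈ y} | ≤.total x y
    ... | yes x≈y | _        = x≈y
    ... | no  x≉y | inj₁ x≤y = contradiction (x≤y , x≉y) x≮y
    ... | no  x≉y | inj₂ y≤x = contradiction (y≤x , λ y≈x → x≉y (sym y≈x)) y≮x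

    square-cancel-≤ : ∀ {x y} → 0# ≤ y → x * x ≤ y * y → x ≤ y
    square-cancel-≤ {x} {y} 0≤y xx≤yy with lem {x ≤ y}
    ... | yes x≤y = x≤y
    ... | no  x≰y = *-cancelʳ-≤ 0<x (begin
      x * x  ≤⟨ xx≤yy ⟩
      y * y  ≤⟨ *-monoʳ-≤ 0≤y (proj₁ (≰⇒> x≰y)) ⟩
      y * x  ∎)
      where
      0<x : 0# < x
      0<x = begin-strict 0# ≤⟨ 0≤y ⟩ y <⟨ ≰⇒> x≰y ⟩ x ∎

    -- With δ = a - s² the increment is ε = δ / (1 + δ + 2s). The part 1 + δ of the denominator
    -- bounds ε itself, whence ε (ε + 2s) ≤ δ.
    square-<⇒∃> : ∀ {s a} → 0# ≤ s → s * s < a → ∃[ t ] (s < t × t * t ≤ a)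
    square-<⇒∃> {s} {a} 0≤s s²<a
      with δ , 0<δ , a≈s²+δ ← <⇒∃+ s²<a
      with 0<1+δ ← +-pos 0<1 (proj₁ 0<δ)
      with 0<D ← +-pos 0<1+δ (+-nonNeg 0≤s 0≤s)
      with ε , εD≈δ , 0<ε ← divide-pos 0<δ 0<D = s + ε , x<x+y 0<ε , (begin
        (s + ε) * (s + ε)               ≈⟨ solve 2 (λ s ε → (s :+ ε) :* (s :+ ε) :=
                                             s :* s :+ ε :* (ε :+ (s :+ s))) refl s ε ⟩
        s * s + ε * (ε + (s + s))       ≤⟨ +-monoʳ-≤ (s * s) (*-monoʳ-≤ (proj₁ 0<ε) (+-monoˡ-≤ (s + s) (ε≤1+δ δ ε 0<δ 0<D εD≈δ))) ⟩
        s * s + ε * (1# + δ + (s + s))  ≈⟨ +-congˡ εD≈δ ⟩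
        s * s + δ                       ≈⟨ a≈s²+δ ⟨
        a                               ∎)
      where
      ε≤1+δ : ∀ δ ε → 0# < δ → 0# < 1# + δ + (s + s) → ε * (1# + δ + (s + s)) ≈ δ → ε ≤ 1# + δ
      ε≤1+δ δ ε 0<δ 0<D εD≈δ = *-cancelʳ-≤ 0<D (begin
        ε * (1# + δ + (s + s))         ≈⟨ εD≈δ ⟩
        δ                              ≤⟨ x≤x+y (+-nonNeg (+-nonNeg 0≤1 (+-nonNeg 0≤s 0≤s)) (*-nonNeg (proj₁ 0<δ) (proj₁ 0<D))) ⟩
        δ + (1# + (s + s) + δ * (1# + δ + (s + s)))
          ≈⟨ solve 2 (λ s δ → δ :+ (con 1 :+ (s :+ s) :+ δ :* (con 1 :+ δ :+ (s :+ s))) :=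
               (con 1 :+ δ) :* (con 1 :+ δ :+ (s :+ s))) refl s δ ⟩
        (1# + δ) * (1# + δ + (s + s))  ∎)

    -- The Newton step t = s − ε with ε (s + s) = s² − a satisfies t² = a + ε².
    square->⇒∃< : ∀ {s a} → 0# < s → 0# ≤ a → a < s * s → ∃[ t ] (0# ≤ t × t < s × a ≤ t * t)
    square->⇒∃< {s} {a} 0<s 0≤a a<s²
      with δ , 0<δ , s²≈a+δ ← <⇒∃+ a<s²
      with 0<2s ← +-pos 0<s (proj₁ 0<s)
      with ε , ε2s≈δ , 0<ε ← divide-pos 0<δ 0<2s
      with t , 0≤t , s≈ε+t ← ≤⇒∃+ {ε} {s} (*-cancelʳ-≤ 0<2s (begin
        ε * (s + s)      ≈⟨ ε2s≈δ ⟩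
        δ                ≤⟨ x≤x+y 0≤a ⟩
        δ + a            ≈⟨ +-comm δ a ⟩
        a + δ            ≈⟨ s²≈a+δ ⟨
        s * s            ≤⟨ *-monoʳ-≤ (proj₁ 0<s) (x≤x+y (proj₁ 0<s)) ⟩
        s * (s + s)      ∎)) = t , 0≤t , (begin-strict
        t      <⟨ x<x+y 0<ε ⟩
        t + ε  ≈⟨ +-comm t ε ⟩
        ε + t  ≈⟨ s≈ε+t ⟨
        s      ∎) , +-cancelʳ-≤ (ε * (ε + t + t)) (begin
        a + ε * (ε + t + t)          ≤⟨ x≤x+y (*-nonNeg (proj₁ 0<ε) (proj₁ 0<ε)) ⟩
        a + ε * (ε + t + t) + ε * ε  ≈⟨ solve 3 (λ a ε t → a :+ ε :* (ε :+ t :+ t) :+ ε :* ε :=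
                                         a :+ ε :* (ε :+ t :+ (ε :+ t))) refl a ε t ⟩
        a + ε * (ε + t + (ε + t))    ≈⟨ +-congˡ (*-congˡ (+-cong s≈ε+t s≈ε+t)) ⟨
        a + ε * (s + s)              ≈⟨ +-congˡ ε2s≈δ ⟩
        a + δ                        ≈⟨ s²≈a+δ ⟨
        s * s                        ≈⟨ *-cong s≈ε+t s≈ε+t ⟩
        (ε + t) * (ε + t)            ≈⟨ solve 2 (λ ε t → (ε :+ t) :* (ε :+ t) :=
                                         t :* t :+ ε :* (ε :+ t :+ t)) refl ε t ⟩
        t * t + ε * (ε + t + t)      ∎)

    -- Since a ≤ (1 + a)². This bounds the set whose supremum is the square root of a.
    x²≤a⇒x≤1+a : ∀ {a} → 0# ≤ a → ∀ x → x * x ≤ a → x ≤ 1# + a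
    x²≤a⇒x≤1+a {a} 0≤a x x²≤a = square-cancel-≤ (+-nonNeg 0≤1 0≤a) (begin
      x * x                ≤⟨ x²≤a ⟩
      a                    ≤⟨ x≤x+y (+-nonNeg (+-nonNeg 0≤1 0≤a) (*-nonNeg 0≤a 0≤a)) ⟩
      a + (1# + a + a * a) ≈⟨ solve 1 (λ a → a :+ (con 1 :+ a :+ a :* a) := (con 1 :+ a) :* (con 1 :+ a)) refl a ⟩
      (1# + a) * (1# + a)  ∎)

-- Roots and unbounded powers from completeness.

module Roots (lem : ExcludedMiddle 0ℓ) (ℝ : CompleteOrderedField) where

  open CompleteOrderedField ℝ
  open OrderedField ℝ
  open Squares lem ℝ
  open PartialOrderReasoning poset
  open Exponentiation semiring using (^-assocʳ; ^-congˡ; ^-congʳ)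

  abstract

    -- If s² < a, a slightly larger number still lies in the set, so s is no upper bound; if a < s²,
    -- a slightly smaller number is already an upper bound, so s is not least.
    square-LUB⇒sqrt : ∀ {a s} → 0# ≤ a → LeastUpperBound (λ x → x * x ≤ a) s → 0# ≤ s × s * s ≈ a
    square-LUB⇒sqrt {a} {s} 0≤a (upper , least) = 0≤s , ≮∧≯⇒≈ ¬s²<a ¬a<s²
      where
      0²≤a : 0# * 0# ≤ a
      0²≤a = ≤.trans (≤.reflexive (zeroˡ 0#)) 0≤a

      0≤s : 0# ≤ s
      0≤s = upper 0# 0²≤a

      ¬s²<a : ¬ s * s < a
      ¬s²<a s²<a with t , s<t , t²≤a ← square-<⇒∃> 0≤s s²<a = <⇒≱ s<t (upper t t²≤a)

      a<s²⇒0<s : a < s * s → 0# < s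
      a<s²⇒0<s a<s² = 0≤s , λ 0≈s → <⇒≱ a<s² (begin
        s * s    ≈⟨ *-cong 0≈s 0≈s ⟨
        0# * 0#  ≤⟨ 0²≤a ⟩
        a        ∎)

      ¬a<s² : ¬ a < s * s
      ¬a<s² a<s² with t , 0≤t , t<s , a≤t² ← square->⇒∃< (a<s²⇒0<s a<s²) 0≤a a<s² =
        <⇒≱ t<s (least t λ x x²≤a → square-cancel-≤ 0≤t (≤.trans x²≤a a≤t²))

    sqrt : ∀ {a} → 0# ≤ a → ∃[ s ] (0# ≤ s × s * s ≈ a)
    sqrt {a} 0≤a =
      let s , s-lub = complete (λ x → x * x ≤ a)
                        (0# , ≤.trans (≤.reflexive (zeroˡ 0#)) 0≤a)
                        (1# + a , x²≤a⇒x≤1+a 0≤a)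
      in s , square-LUB⇒sqrt 0≤a s-lub

    -- As q is a power of two, iterated square roots suffice.
    2^n-root : ∀ n {a} → 0# ≤ a → ∃ (IsNthRoot (2 ℕ.^ n) a)
    2^n-root zero {a} 0≤a = a , 0≤a , *-identityʳ a
    2^n-root (suc n) {a} 0≤a
      with s , 0≤s , s²≈a ← sqrt 0≤a
      with c , 0≤c , c^2^n≈s ← 2^n-root n 0≤s = c , 0≤c , (begin-equality
        c ^ (2 ℕ.* 2 ℕ.^ n)    ≈⟨ ^-congʳ c (ℕₚ.*-comm 2 (2 ℕ.^ n)) ⟩
        c ^ (2 ℕ.^ n ℕ.* 2)    ≈⟨ ^-assocʳ c (2 ℕ.^ n) 2 ⟨
        (c ^ (2 ℕ.^ n)) ^ 2    ≈⟨ ^-congˡ 2 c^2^n≈s ⟩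
        s * (s * 1#)           ≈⟨ *-congˡ (*-identityʳ s) ⟩
        s * s                  ≈⟨ s²≈a ⟩
        a                      ∎)

    power-bound⇒≤1 : ∀ {c x} → 0# < c → (∀ n → c ^ n ≤ x) → c ≤ 1#
    power-bound⇒≤1 {c} {x} 0<c c^n≤x = case complete P (1# , 0 , refl) (x , bound) of
      λ (s , upper , least) → c≤1 (upper _ (0 , refl)) (λ n → upper _ (n , refl)) (least _)
      where
      P : Carrier → Set
      P y = ∃[ n ] y ≈ c ^ n

      bound : UpperBound P x
      bound y (n , y≈c^n) = ≤.trans (≤.reflexive y≈c^n) (c^n≤x n)

      -- s / c is again an upper bound, so s ≤ s / c.
      c≤1 : ∀ {s} → 1# ≤ s → (∀ n → c ^ n ≤ s) →
            (UpperBound P (s / c ⟨ >⇒≉0 0<c ⟩) → s ≤ s / c ⟨ >⇒≉0 0<c ⟩) → c ≤ 1#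
      c≤1 {s} 1≤s upper least = *-cancelʳ-≤ (begin-strict 0# <⟨ 0<1 ⟩ 1# ≤⟨ 1≤s ⟩ s ∎) (begin
        c * s                     ≈⟨ *-comm c s ⟩
        s * c                     ≤⟨ *-monoˡ-≤ (proj₁ 0<c) (least λ y (n , y≈c^n) → *-cancelʳ-≤ 0<c (begin
                                       y * c                  ≈⟨ *-comm y c ⟩
                                       c * y                  ≈⟨ *-congˡ y≈c^n ⟩
                                       c ^ suc n              ≤⟨ upper (suc n) ⟩
                                       s                      ≈⟨ x/y*y≈x s (>⇒≉0 0<c) ⟨
                                       s / c ⟨ >⇒≉0 0<c ⟩ * c ∎)) ⟩
        s / c ⟨ >⇒≉0 0<c ⟩ * c    ≈⟨ x/y*y≈x s (>⇒≉0 0<c) ⟩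
        s                         ≈⟨ *-identityˡ s ⟨
        1# * s                    ∎)

    -- A multiplicative Archimedean property. With base `b` it makes every geometric strategy reach
    -- every target; with base `c` it gives every target a level.
    powers-unbounded : ∀ {c} → 1# < c → ∀ x → ∃[ n ] x ≤ c ^ n
    powers-unbounded {c} 1<c x with lem {∃[ n ] x ≤ c ^ n}
    ... | yes found = found
    ... | no  none  = contradiction
      (power-bound⇒≤1 (1<x⇒0<x 1<c) λ n → proj₁ (≰⇒> λ x≤c^n → none (n , x≤c^n)))
      (<⇒≱ 1<c)

-- The numbers r and ρ, and the root equation without division.

module Ratio (ℝ : CompleteOrderedField) where

  open CompleteOrderedField ℝ
  open OrderedField ℝ
  open PartialOrderReasoning poset
  open GroupProperties +-group using (∙-cancelʳ; //-rightDividesˡ; x∙y⁻¹≈ε⇒x≈y)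
  open SemiringSolver commutativeSemiring using (Polynomial; solve; con; _:=_; _:+_; _:*_)

  abstract

    ρ*2+1≈r : ∀ r → ρ r * 2 · 1# + 1# ≈ r
    ρ*2+1≈r r = trans (+-congʳ (x/y*y≈x (r - 1#) 2≉0)) (//-rightDividesˡ 1# r)

    r≈1+2ρ : ∀ r → r ≈ 1# + 2 · ρ r
    r≈1+2ρ r = trans (sym (ρ*2+1≈r r))
      (solve 1 (λ p → p :* (con 1 :+ (con 1 :+ con 0)) :+ con 1 := con 1 :+ (p :+ (p :+ con 0))) refl (ρ r))

    -- With u = (r - 9) / 4 and h = 2 + u this reads ρ = 2h, and the quantity h (h - 2) = h u under
    -- the square root is visibly nonnegative.
    ρ≈4+2u : ∀ {r} → 9 · 1# ≤ r → ∃[ u ] (0# ≤ u × ρ r ≈ 2 · 1# + u + (2 · 1# + u))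
    ρ≈4+2u {r} 9≤r
      with e , 0≤e , r≈9+e ← ≤⇒∃+ 9≤r
      with 0<4 ← n·1-pos 3
      with u , u*4≈e , 0≤u ← divide-nonNeg 0≤e 0<4
      = u , 0≤u , *-cancelʳ-≈ 2≉0 (∙-cancelʳ 1# _ _ (begin-equality
      ρ r * 2 · 1# + 1#                                ≈⟨ ρ*2+1≈r r ⟩
      r                                                ≈⟨ r≈9+e ⟩
      9 · 1# + e                                       ≈⟨ +-congˡ u*4≈e ⟨
      9 · 1# + u * 4 · 1#                              ≈⟨ solve 1 (λ u → n·1 9 :+ u :* n·1 4 :=
        (n·1 2 :+ u :+ (n·1 2 :+ u)) :* n·1 2 :+ con 1) refl u ⟩
      (2 · 1# + u + (2 · 1# + u)) * 2 · 1# + 1#        ∎))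
      where
      n·1 : ℕ → Polynomial 1
      n·1 zero    = con 0
      n·1 (suc n) = con 1 :+ n·1 n

    x[y-1]+x≈xy : ∀ x y → x * (y - 1#) + x ≈ x * y
    x[y-1]+x≈xy x y = begin-equality
      x * (y - 1#) + x       ≈⟨ +-congˡ (*-identityʳ x) ⟨
      x * (y - 1#) + x * 1#  ≈⟨ distribˡ x (y - 1#) 1# ⟨
      x * (y - 1# + 1#)      ≈⟨ *-congˡ (//-rightDividesˡ 1# y) ⟩
      x * y                  ∎

    -- Clears the denominator and moves ρ across, which leaves a quadratic equation that the
    -- semiring solver can handle.
    x²/[x-1]≈ρ⇒x²+ρ≈ρx : ∀ {r x} → IsRoot r x → x * x + ρ r ≈ ρ r * x
    x²/[x-1]≈ρ⇒x²+ρ≈ρx {r} {x} (x-1≉0 , root) = begin-equality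
      x * x + ρ r                                  ≈⟨ +-congʳ (x/y*y≈x (x * x) x-1≉0) ⟨
      x * x / (x - 1#) ⟨ x-1≉0 ⟩ * (x - 1#) + ρ r  ≈⟨ +-congʳ (*-congʳ (x∙y⁻¹≈ε⇒x≈y _ _ root)) ⟩
      ρ r * (x - 1#) + ρ r                         ≈⟨ x[y-1]+x≈xy (ρ r) x ⟩
      ρ r * x                                      ∎

    x²+ρ≈ρx⇒x²≈ρ[x-1] : ∀ {r x} → x * x + ρ r ≈ ρ r * x → x * x ≈ ρ r * (x - 1#)
    x²+ρ≈ρx⇒x²≈ρ[x-1] {r} {x} eq = ∙-cancelʳ (ρ r) _ _ (trans eq (sym (x[y-1]+x≈xy (ρ r) x)))

-- Existence and maximality of b_r.

module LargestRoot (lem : ExcludedMiddle 0ℓ) (ℝ : CompleteOrderedField) where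

  open CompleteOrderedField ℝ
  open OrderedField ℝ
  open Roots lem ℝ
  open Ratio ℝ
  open PartialOrderReasoning poset
  open GroupProperties +-group using (x∙y⁻¹≈ε⇒x≈y; x≈y⇒x∙y⁻¹≈ε)
  open SemiringSolver commutativeSemiring using (solve; con; _:=_; _:+_; _:*_)

  abstract

    -- With ρ = 2h the roots of x² / (x − 1) = ρ are h ± √(h (h − 2)).
    largest-root : ∀ {r} → 9 · 1# ≤ r → ∃[ b ] (IsLargestRoot r b × 1# < b × b * b ≈ ρ r * (b - 1#))
    largest-root {r} 9≤r
      with u , 0≤u , ρ≈h+h ← ρ≈4+2u 9≤r
      with 0≤h ← +-nonNeg (n·1-nonNeg 2) 0≤u
      with s , 0≤s , s²≈hu ← sqrt (*-nonNeg 0≤h 0≤u) =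
        b , (((b-1≉0 , x≈y⇒x∙y⁻¹≈ε (trans (*-congʳ b²≈ρ[b-1]) (x*y/y≈x (ρ r) b-1≉0))) , largest) , 1<b , b²≈ρ[b-1])
      where
      h b : Carrier
      h = 2 · 1# + u
      b = h + s

      b²+ρ≈ρb : b * b + ρ r ≈ ρ r * b
      b²+ρ≈ρb = begin-equality
        b * b + ρ r                            ≈⟨ +-congˡ ρ≈h+h ⟩
        b * b + (h + h)                        ≈⟨ solve 2 (λ h s → (h :+ s) :* (h :+ s) :+ (h :+ h) :=
          h :* h :+ (h :+ h) :* s :+ s :* s :+ (h :+ h)) refl h s ⟩
        h * h + (h + h) * s + s * s + (h + h)  ≈⟨ +-congʳ (+-congˡ s²≈hu) ⟩
        -- Here `h` has to be unfolded to 2 + u: the terms without `s` add up to h (h + u + 2) =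
        -- 2h².
        h * h + (h + h) * s + h * u + (h + h)  ≈⟨ solve 2 (λ u s → let h = con 1 :+ (con 1 :+ con 0) :+ u in
          h :* h :+ (h :+ h) :* s :+ h :* u :+ (h :+ h) := (h :+ h) :* (h :+ s)) refl u s ⟩
        (h + h) * b                            ≈⟨ *-congʳ ρ≈h+h ⟨
        ρ r * b                                ∎

      b²≈ρ[b-1] : b * b ≈ ρ r * (b - 1#)
      b²≈ρ[b-1] = x²+ρ≈ρx⇒x²≈ρ[x-1] b²+ρ≈ρb

      1<b : 1# < b
      1<b = begin-strict
        1#                      <⟨ x<x+y (+-pos 0<1 (+-nonNeg 0≤u 0≤s)) ⟩
        1# + (1# + (u + s))     ≈⟨ solve 2 (λ u s → con 1 :+ (con 1 :+ (u :+ s)) := con 1 :+ (con 1 :+ con 0) :+ u :+ s) refl u s ⟩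
        b                       ∎

      b-1≉0 : b - 1# ≉ 0#
      b-1≉0 b-1≈0 = proj₂ 1<b (sym (x∙y⁻¹≈ε⇒x≈y b 1# b-1≈0))

      largest : ∀ x → IsRoot r x → x ≤ b
      largest x root with lem {x ≤ b}
      ... | yes x≤b = x≤b
      -- At x = b + d the quadratic x² + ρ - ρx equals d (d + 2s), which is positive, so x is not a
      -- root.
      ... | no  x≰b with d , 0<d , x≈b+d ← <⇒∃+ (≰⇒> x≰b) =
        contradiction (begin-strict
          ρ r * x                                    ≈⟨ *-congˡ x≈b+d ⟩
          ρ r * (b + d)                              ≈⟨ distribˡ (ρ r) b d ⟩
          ρ r * b + ρ r * d                          ≈⟨ +-congʳ b²+ρ≈ρb ⟨
          b * b + ρ r + ρ r * d                      <⟨ x<x+y (*-pos (+-pos 0<d (+-nonNeg 0≤s 0≤s)) 0<d) ⟩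
          b * b + ρ r + ρ r * d + (d + (s + s)) * d  ≈⟨ +-congʳ (+-cong (+-congˡ ρ≈h+h) (*-congʳ ρ≈h+h)) ⟩
          b * b + (h + h) + (h + h) * d + (d + (s + s)) * d
            ≈⟨ solve 3 (λ h s d → (h :+ s) :* (h :+ s) :+ (h :+ h) :+ (h :+ h) :* d :+ (d :+ (s :+ s)) :* d :=
                 (h :+ s :+ d) :* (h :+ s :+ d) :+ (h :+ h)) refl h s d ⟩
          (b + d) * (b + d) + (h + h)                ≈⟨ +-cong (*-cong x≈b+d x≈b+d) ρ≈h+h ⟨
          x * x + ρ r                                ≈⟨ x²/[x-1]≈ρ⇒x²+ρ≈ρx root ⟩
          ρ r * x                                    ∎) (<-irrefl refl)

-- Binary numerals and division by powers of two.

parity : ∀ n → ∃[ i ] (n ≡ i ℕ.* 2 ⊎ n ≡ 1 ℕ.+ i ℕ.* 2)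
parity zero    = 0 , inj₁ ≡.refl
parity (suc n) with parity n
... | i , inj₁ n≡2i   = i , inj₂ (≡.cong suc n≡2i)
... | i , inj₂ n≡1+2i = suc i , inj₁ (≡.cong suc n≡1+2i)

value : ∀ {m} → Vec Bool m → ℕ
value             []          = 0
value             (false ∷ v) = value v
value {m = suc m} (true  ∷ v) = 2 ℕ.^ m ℕ.+ value v

-- Serves to show that the scaling factor `c ^ value v` is at most c^q = b, for which the non-strict
-- bound suffices.
value≤2^m : ∀ {m} (v : Vec Bool m) → value v ℕ.≤ 2 ℕ.^ m
value≤2^m             []          = ℕ.z≤n
value≤2^m {m = suc m} (false ∷ v) = ℕₚ.≤-trans (value≤2^m v) (ℕₚ.m≤m+n (2 ℕ.^ m) _)
value≤2^m {m = suc m} (true  ∷ v) =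
  ℕₚ.+-monoʳ-≤ (2 ℕ.^ m) (ℕₚ.≤-trans (value≤2^m v) (ℕₚ.m≤m+n (2 ℕ.^ m) _))

-- Induction on `m`: the parity of the quotient by 2^m becomes the new leading bit, and half of that
-- quotient, rounded down, is the new quotient.
divMod2^m : ∀ m n → Σ[ v ∈ Vec Bool m ] ∃[ i ] n ≡ value v ℕ.+ i ℕ.* 2 ℕ.^ m
divMod2^m zero    n = [] , n , ≡.sym (ℕₚ.*-identityʳ n)
divMod2^m (suc m) n with divMod2^m m n
... | v , i , n≡v+iq with parity i
...   | j , inj₁ ≡.refl = false ∷ v , j , ≡.trans n≡v+iq (≡.cong (value v ℕ.+_) (ℕₚ.*-assoc j 2 (2 ℕ.^ m)))
...   | j , inj₂ ≡.refl = true ∷ v , j , (begin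
  n                                                ≡⟨ n≡v+iq ⟩
  value v ℕ.+ (2 ℕ.^ m ℕ.+ j ℕ.* 2 ℕ.* 2 ℕ.^ m)    ≡⟨ ℕₚ.+-assoc (value v) (2 ℕ.^ m) _ ⟨
  value v ℕ.+ 2 ℕ.^ m ℕ.+ j ℕ.* 2 ℕ.* 2 ℕ.^ m      ≡⟨ ≡.cong₂ ℕ._+_ (ℕₚ.+-comm (value v) (2 ℕ.^ m)) (ℕₚ.*-assoc j 2 (2 ℕ.^ m)) ⟩
  2 ℕ.^ m ℕ.+ value v ℕ.+ j ℕ.* 2 ℕ.^ suc m        ∎)
  where open ≡-Reasoning

-- Alternation between the two rays.

alternate : Bool → ℕ → Fin 2
alternate s     (suc i) = alternate (not s) i
alternate false zero    = Fin.zero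
alternate true  zero    = Fin.suc Fin.zero

-- The recursion flips the starting ray, so two steps amount to a double negation.
alternate-periodic : ∀ s i → alternate s (suc (suc i)) ≡ alternate s i
alternate-periodic s i = ≡.cong (λ s → alternate s i) (not-involutive s)

-- Supplies the advice bit that makes the intended iteration take place on the target's ray.
alternate-hits : ∀ i u → ∃[ s ] alternate s i ≡ u
alternate-hits zero    Fin.zero           = false , ≡.refl
alternate-hits zero    (Fin.suc Fin.zero) = true , ≡.refl
alternate-hits (suc i) u with alternate-hits i u
... | s , hit = not s , ≡.trans (≡.cong (λ s → alternate s i) (not-involutive s)) hit

alternate-covers : ∀ s i u → alternate s i ≡ u ⊎ alternate s (suc i) ≡ u
alternate-covers false zero    Fin.zero           = inj₁ ≡.refl
alternate-covers false zero    (Fin.suc Fin.zero) = inj₂ ≡.refl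
alternate-covers true  zero    Fin.zero           = inj₂ ≡.refl
alternate-covers true  zero    (Fin.suc Fin.zero) = inj₁ ≡.refl
alternate-covers s     (suc i) u                  = alternate-covers (not s) i u

-- Least witnesses.

Least : (ℕ → Set) → ℕ → Set
Least P n = P n × (∀ m → m ℕ.< n → ¬ P m)

least : ExcludedMiddle 0ℓ → ∀ (P : ℕ → Set) n → P n → ∃ (Least P)
least lem P n Pn with lem {P 0}
least lem P n       Pn | yes P0 = 0 , P0 , λ _ ()
least lem P zero    Pn | no ¬P0 = contradiction Pn ¬P0
least lem P (suc n) Pn | no ¬P0 with least lem (λ i → P (suc i)) n Pn
... | i , Pi , minimal = suc i , Pi , λ where
  zero    _             → ¬P0
  (suc j) (ℕ.s≤s j<i) → minimal j j<i

-- Two equivalent predicates are allowed because targets that agree only up to `_≈ᵗ_` have distinct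
-- but equivalent level predicates.
Least-unique : ∀ {P Q : ℕ → Set} {m n} → (∀ i → P i → Q i) → (∀ i → Q i → P i) → Least P m → Least Q n → m ≡ n
Least-unique {m = m} {n} P⇒Q Q⇒P (Pm , below-m) (Qn , below-n) = ℕₚ.≤-antisym
  (ℕₚ.≮⇒≥ λ n<m → below-m n n<m (Q⇒P n Qn))
  (ℕₚ.≮⇒≥ λ m<n → below-n m m<n (P⇒Q m Pm))

-- Suprema of bounded families of extended reals.

module Suprema (lem : ExcludedMiddle 0ℓ) (ℝ : CompleteOrderedField) where

  open CompleteOrderedField ℝ
  open LineSearch lem ℝ
  open NaturalMax ℝ⁺-totalOrder using (⊔-lub)
  open TotalOrder ℝ⁺-totalOrder using () renaming (trans to ≤⁺-trans)

  maxBits-lub : ∀ {k} (f : Vec Bool k → Carrier ⁺) {u} → (∀ h → f h ≤⁺ u) → maxBits f ≤⁺ u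
  maxBits-lub {zero}  f f≤u = f≤u []
  maxBits-lub {suc k} f f≤u =
    ⊔-lub (maxBits-lub (λ h → f (false ∷ h)) λ h → f≤u (false ∷ h))
          (maxBits-lub (λ h → f (true ∷ h)) λ h → f≤u (true ∷ h))

  -- Completeness is applied to the reals lying below some value of `f`. The finite bound rules out
  -- the value `⊤⁺`, and `i₀` makes the set inhabited.
  bounded-sup : ∀ {I : Set} → I → (f : I → Carrier ⁺) → ∀ {u} → (∀ i → f i ≤⁺ [ u ]) →
                ∃[ s ] (IsSup f s × s ≤⁺ [ u ])
  bounded-sup {I} i₀ f {u} f≤u =
    let s , upper , least = complete P inhabited (u , bounded)
    in [ s ] , ((λ i → f≤ upper i) , λ v f≤v → ≤v least v f≤v) , [ least u bounded ]
    where
    P : Carrier → Set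
    P x = ∃[ i ] [ x ] ≤⁺ f i

    bounded : UpperBound P u
    bounded x (i , x≤fi) = [≤]-injective _≤_ (≤⁺-trans x≤fi (f≤u i))

    inhabited : ∃ P
    inhabited with f i₀ in fi₀≡ | f≤u i₀
    ... | [ x ] | [ _ ] = x , i₀ , ≡.subst ([ x ] ≤⁺_) (≡.sym fi₀≡) [ ≤.refl ]

    f≤ : ∀ {s} → UpperBound P s → ∀ i → f i ≤⁺ [ s ]
    f≤ upper i with f i in eq | f≤u i
    ... | [ x ] | [ _ ] = [ upper x (i , ≡.subst ([ x ] ≤⁺_) (≡.sym eq) [ ≤.refl ]) ]

    ≤v : ∀ {s} → (∀ v → UpperBound P v → s ≤ v) → ∀ v → (∀ i → f i ≤⁺ v) → [ s ] ≤⁺ v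
    ≤v least ⊤⁺    _   = [ _ ] ≤⊤⁺
    ≤v least [ v ] f≤v = [ least v (λ x (i , x≤fi) → [≤]-injective _≤_ (≤⁺-trans x≤fi (f≤v i))) ]

-- Geometric sums.

module GeometricSum (ℝ : CompleteOrderedField) where

  open CompleteOrderedField ℝ
  open OrderedField ℝ
  open PartialOrderReasoning poset
  open GroupProperties +-group using (//-rightDividesˡ)
  open SemiringSolver commutativeSemiring using (solve; con; _:=_; _:+_; _:*_)

  abstract

    -- Like `sum`, the induction splits off the first term, so its hypothesis is applied to the
    -- shifted sequence, whose first term is b f(0).
    geometric-sum : ∀ {b} (f : ℕ → Carrier) → (∀ i → f (suc i) ≈ b * f i) →
                    ∀ i → sum {i} (λ j → f (toℕ j)) * (b - 1#) + f 0 ≈ f i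
    geometric-sum {b} f step zero = trans (+-congʳ (zeroˡ (b - 1#))) (+-identityˡ (f 0))
    geometric-sum {b} f step (suc i) = begin-equality
      (f 0 + S) * (b - 1#) + f 0          ≈⟨ solve 3 (λ f₀ S β → (f₀ :+ S) :* β :+ f₀ :=
                                               S :* β :+ (β :+ con 1) :* f₀) refl (f 0) S (b - 1#) ⟩
      S * (b - 1#) + (b - 1# + 1#) * f 0  ≈⟨ +-congˡ (*-congʳ (//-rightDividesˡ 1# b)) ⟩
      S * (b - 1#) + b * f 0              ≈⟨ +-congˡ (step 0) ⟨
      S * (b - 1#) + f 1                  ≈⟨ geometric-sum (λ j → f (suc j)) (λ j → step (suc j)) i ⟩
      f (suc i)                           ∎
      where
      S : Carrier
      S = sum {i} (λ j → f (suc (toℕ j)))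

    -- Drops the first term from `geometric-sum` and cancels the positive factor b - 1.
    geometric-sum-≤ : ∀ {b M x} (f : ℕ → Carrier) → (∀ i → f (suc i) ≈ b * f i) → 1# < b → 0# ≤ f 0 →
                      ∀ i → f i ≤ M * (b - 1#) * x → sum {i} (λ j → f (toℕ j)) ≤ M * x
    geometric-sum-≤ {b} {M} {x} f step 1<b 0≤f0 i fi≤ = *-cancelʳ-≤ (0<y-x 1<b) (begin
      S * (b - 1#)        ≤⟨ x≤x+y 0≤f0 ⟩
      S * (b - 1#) + f 0  ≈⟨ geometric-sum f step i ⟩
      f i                 ≤⟨ fi≤ ⟩
      M * (b - 1#) * x    ≈⟨ solve 3 (λ M β x → M :* β :* x := M :* x :* β) refl M (b - 1#) x ⟩
      M * x * (b - 1#)    ∎)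
      where
      S : Carrier
      S = sum {i} (λ j → f (toℕ j))

-- The geometric strategies and their costs.

module GeometricSearch (lem : ExcludedMiddle 0ℓ) (ℝ : CompleteOrderedField) where

  open CompleteOrderedField ℝ
  open LineSearch lem ℝ
  open OrderedField ℝ
  open Roots lem ℝ
  open GeometricSum ℝ
  open Suprema lem ℝ
  open TotalOrder ℝ⁺-totalOrder using () renaming (trans to ≤⁺-trans)
  open PartialOrderReasoning poset
  open SemiringSolver commutativeSemiring using (solve; con; _:=_; _:+_; _:*_)
  open Exponentiation semiring using (^-homo-*; ^-assocʳ; ^-congˡ; ^-congʳ)

  module Advice
    (d₀ : Carrier) (d₀>0 : 0# < d₀)
    (m : ℕ) (b c : Carrier) (1<b : 1# < b) (c-root : IsNthRoot (2 ℕ.^ m) b c)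
    where

    open Search d₀ d₀>0

    q : ℕ
    q = 2 ℕ.^ m

    abstract

      0<b : 0# < b
      0<b = 1<x⇒0<x 1<b

      1<c : 1# < c
      1<c = ≰⇒> λ c≤1 → <⇒≱ 1<b (begin
        b      ≈⟨ proj₂ c-root ⟨
        c ^ q  ≤⟨ x≤1⇒x^n≤1 (proj₁ c-root) c≤1 q ⟩
        1#     ∎)

      0<c : 0# < c
      0<c = 1<x⇒0<x 1<c

      c^value≤b : (v : Vec Bool m) → c ^ value v ≤ b
      c^value≤b v = begin
        c ^ value v  ≤⟨ ^-monoʳ-≤ (proj₁ 1<c) (value≤2^m v) ⟩
        c ^ q        ≈⟨ proj₂ c-root ⟩
        b            ∎

      c^[v+iq]≈c^v*b^i : ∀ v i → c ^ (v ℕ.+ i ℕ.* q) ≈ c ^ v * b ^ i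
      c^[v+iq]≈c^v*b^i v i = begin-equality
        c ^ (v ℕ.+ i ℕ.* q)    ≈⟨ ^-homo-* c v (i ℕ.* q) ⟩
        c ^ v * c ^ (i ℕ.* q)  ≈⟨ *-congˡ (^-congʳ c (ℕₚ.*-comm i q)) ⟩
        c ^ v * c ^ (q ℕ.* i)  ≈⟨ *-congˡ (^-assocʳ c q i) ⟨
        c ^ v * (c ^ q) ^ i    ≈⟨ *-congˡ (^-congˡ i (proj₂ c-root)) ⟩
        c ^ v * b ^ i          ∎

    -- The scale puts the initial turning point between d₀ and b d₀, which keeps the first two
    -- iterations within the robustness bound.
    geometric : Vec Bool (suc m) → Strategy
    geometric (s ∷ v) = record
      { turn   = λ i → d₀ * c ^ value v * b ^ i
      ; turn>0 = λ i → *-pos (*-pos d₀>0 (^-pos 0<c (value v))) (^-pos 0<b i)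
      ; ray    = alternate s
      }

    module _ (s : Bool) (v : Vec Bool m) (t : Target) where

      open Target t using (dist; d₀≤dist) renaming (ray to u)

      private
        X = geometric (s ∷ v)
        A = d₀ * c ^ value v
        open Strategy X using (turn; turn>0)

      abstract

        0<dist : 0# < dist
        0<dist = begin-strict 0# <⟨ d₀>0 ⟩ d₀ ≤⟨ d₀≤dist ⟩ dist ∎

        turn-suc : ∀ i → turn (suc i) ≈ b * turn i
        turn-suc i = solve 3 (λ A b p → A :* (b :* p) := b :* (A :* p)) refl A b (b ^ i)

        turn-≤-suc : ∀ i → turn i ≤ turn (suc i)
        turn-≤-suc i = *-monoʳ-≤ (*-nonNeg (proj₁ d₀>0) (^-nonNeg (proj₁ 0<c) (value v))) (x^n≤x^[1+n] (proj₁ 1<b) i)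

        turn-mono-≤ : ∀ {i j} → i ℕ.≤ j → turn i ≤ turn j
        turn-mono-≤ i≤j = *-monoʳ-≤ (*-nonNeg (proj₁ d₀>0) (^-nonNeg (proj₁ 0<c) (value v))) (^-monoʳ-≤ (proj₁ 1<b) i≤j)

        0<A : 0# < A
        0<A = *-pos d₀>0 (^-pos 0<c (value v))

        -- If iteration `n` is on the wrong ray, the next one is on the right ray and at least as
        -- long.
        d≤turn⇒reaches : ∀ n → dist ≤ turn n → ∃ (Reaches X t)
        d≤turn⇒reaches n d≤turn with alternate-covers s n u
        ... | inj₁ hit = n , hit , d≤turn
        ... | inj₂ hit = suc n , hit , ≤.trans d≤turn (turn-≤-suc n)

        reaches : ∃ (Reaches X t)
        reaches with n , d/A≤b^n ← powers-unbounded 1<b (dist / A ⟨ >⇒≉0 0<A ⟩) = d≤turn⇒reaches n (begin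
          dist                       ≈⟨ x/y*y≈x dist (>⇒≉0 0<A) ⟨
          dist / A ⟨ >⇒≉0 0<A ⟩ * A  ≤⟨ *-monoˡ-≤ (proj₁ 0<A) d/A≤b^n ⟩
          b ^ n * A                  ≈⟨ *-comm (b ^ n) A ⟩
          turn n                     ∎)

        -- Used with M = ρ for the robustness and with M = c / (b - 1) for the consistency.
        ratio≤ : ∀ M → (∀ i → FirstReaches X t i → turn i ≤ M * (b - 1#) * dist) →
                 ratio X t ≤⁺ [ 1# + 2 · M ]
        -- Abstracting this instance of `lem` also resolves the case split inside `cost`.
        ratio≤ M turn≤ with lem {∃ (FirstReaches X t)}
        ... | no unreached  = contradiction (least lem (Reaches X t) (proj₁ reaches) (proj₂ reaches)) unreached
        ... | yes (i , first) = [ x/y≤z (Target.dist≉0 t) 0<dist (begin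
          dist + (S + (S + 0#))              ≤⟨ +-monoʳ-≤ dist (+-mono-≤ S≤ (+-monoˡ-≤ 0# S≤)) ⟩
          dist + (M * dist + (M * dist + 0#)) ≈⟨ solve 2 (λ d M → d :+ (M :* d :+ (M :* d :+ con 0)) :=
                                                   (con 1 :+ (M :+ (M :+ con 0))) :* d) refl dist M ⟩
          (1# + 2 · M) * dist                ∎) ]
          where
          S : Carrier
          S = sum {i} (λ j → turn (toℕ j))
          S≤ : S ≤ M * dist
          S≤ = geometric-sum-≤ turn turn-suc 1<b (proj₁ (turn>0 0)) i (turn≤ i first)

        turn1≤b²d : turn 1 ≤ b * b * dist
        turn1≤b²d = begin
          A * (b * 1#)         ≤⟨ *-monoˡ-≤ (*-nonNeg (proj₁ 0<b) 0≤1)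
                                    (*-mono-≤ (^-nonNeg (proj₁ 0<c) (value v)) (proj₁ 0<dist) d₀≤dist (c^value≤b v)) ⟩
          dist * b * (b * 1#)  ≈⟨ solve 2 (λ d b → d :* b :* (b :* con 1) := b :* b :* d) refl dist b ⟩
          b * b * dist         ∎

        first-turn≤b²d : ∀ i → FirstReaches X t i → turn i ≤ b * b * dist
        first-turn≤b²d (suc (suc i)) ((hit , _) , unreached) = begin
          turn (suc (suc i))   ≈⟨ turn-suc (suc i) ⟩
          b * turn (suc i)     ≈⟨ *-congˡ (turn-suc i) ⟩
          b * (b * turn i)     ≈⟨ *-assoc b b (turn i) ⟨
          -- Iteration `i` visits the same ray as iteration i + 2 without reaching the target, so it
          -- turned short of it.
          b * b * turn i       ≤⟨ *-monoʳ-≤ (proj₁ (*-pos 0<b 0<b)) (proj₁ (≰⇒> λ d≤turn →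
                                    unreached i (ℕₚ.m≤n+m (suc i) 1) (≡.trans (≡.sym (alternate-periodic s i)) hit , d≤turn))) ⟩
          b * b * dist         ∎
        first-turn≤b²d (suc zero) _ = turn1≤b²d
        first-turn≤b²d zero       _ = ≤.trans (turn-≤-suc 0) turn1≤b²d

    -- The level of a target and the advice that encodes it.

    level : (t : Target) → ∃ (Least (λ n → Target.dist t ≤ d₀ * c ^ n))
    level t = case powers-unbounded 1<c (dist / d₀ ⟨ >⇒≉0 d₀>0 ⟩) of λ (n , d/d₀≤c^n) →
      least lem _ n (begin
        dist                              ≈⟨ x/y*y≈x dist (>⇒≉0 d₀>0) ⟨
        dist / d₀ ⟨ >⇒≉0 d₀>0 ⟩ * d₀      ≤⟨ *-monoˡ-≤ (proj₁ d₀>0) d/d₀≤c^n ⟩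
        c ^ n * d₀                        ≈⟨ *-comm (c ^ n) d₀ ⟩
        d₀ * c ^ n                        ∎)
      where open Target t using (dist)

    -- For positive `n`, minimality puts the preceding power d₀ cⁿ⁻¹ below d; for n = 0 the standing
    -- assumption d₀ ≤ d takes its place.
    least-level≤cd : ∀ t n → Least (λ n → Target.dist t ≤ d₀ * c ^ n) n → d₀ * c ^ n ≤ c * Target.dist t
    least-level≤cd t zero    _ = begin
      d₀ * 1#   ≈⟨ *-comm d₀ 1# ⟩
      1# * d₀   ≤⟨ *-mono-≤ (proj₁ d₀>0) (proj₁ 0<c) (proj₁ 1<c) (Target.d₀≤dist t) ⟩
      c * dist  ∎
      where open Target t using (dist)
    least-level≤cd t (suc n) (_ , minimal) = begin
      d₀ * (c * c ^ n)  ≈⟨ solve 3 (λ d c p → d :* (c :* p) := c :* (d :* p)) refl d₀ c (c ^ n) ⟩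
      c * (d₀ * c ^ n)  ≤⟨ *-monoʳ-≤ (proj₁ 0<c) (proj₁ (≰⇒> (minimal n ℕₚ.≤-refl))) ⟩
      c * Target.dist t ∎

    offset : ℕ → Vec Bool m
    offset n = proj₁ (divMod2^m m n)

    iteration : ℕ → ℕ
    iteration n = proj₁ (proj₂ (divMod2^m m n))

    firstRay : ℕ → Fin 2 → Bool
    firstRay n u = proj₁ (alternate-hits (iteration n) u)

    -- The advice depends on the target through its level and ray only, which is what makes it
    -- respect `_≈ᵗ_`.
    code : ℕ → Fin 2 → Vec Bool (suc m)
    code n u = firstRay n u ∷ offset n

    adviceStrategy : AdviceStrategy (suc m)
    adviceStrategy = record
      { advice      = λ t → code (proj₁ (level t)) (Target.ray t)
      ; advice-cong = λ {t} {t′} (ray≡ , dist≈) → ≡.cong₂ code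
          (Least-unique (λ _ → ≤.≤-respˡ-≈ dist≈) (λ _ → ≤.≤-respˡ-≈ (sym dist≈))
            (proj₂ (level t)) (proj₂ (level t′)))
          ray≡
      ; strategy    = geometric
      }

    turn-iteration≈d₀c^n : ∀ n u → Strategy.turn (geometric (code n u)) (iteration n) ≈ d₀ * c ^ n
    turn-iteration≈d₀c^n n u = begin-equality
      d₀ * c ^ value (offset n) * b ^ iteration n          ≈⟨ *-assoc d₀ (c ^ value (offset n)) (b ^ iteration n) ⟩
      d₀ * (c ^ value (offset n) * b ^ iteration n)        ≈⟨ *-congˡ (c^[v+iq]≈c^v*b^i (value (offset n)) (iteration n)) ⟨
      d₀ * c ^ (value (offset n) ℕ.+ iteration n ℕ.* q)    ≈⟨ *-congˡ (^-congʳ c (proj₂ (proj₂ (divMod2^m m n)))) ⟨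
      d₀ * c ^ n                                           ∎

    -- Iteration `iteration n` is on the target's ray and turns at d₀ cⁿ ≥ d, so the first success
    -- `j` comes no later, and turning points increase with the iteration.
    coded-first-turn≤cd : ∀ t n → Least (λ n → Target.dist t ≤ d₀ * c ^ n) n →
      ∀ j → FirstReaches (geometric (code n (Target.ray t))) t j →
      Strategy.turn (geometric (code n (Target.ray t))) j ≤ c * Target.dist t
    coded-first-turn≤cd t n n-least j (_ , unreached) = begin
      turn j              ≤⟨ turn-mono-≤ (firstRay n ray) (offset n) t (ℕₚ.≮⇒≥ λ i<j → unreached (iteration n) i<j
                               ( proj₂ (alternate-hits (iteration n) ray)
                               , ≤.≤-respʳ-≈ (sym (turn-iteration≈d₀c^n n ray)) (proj₁ n-least))) ⟩
      turn (iteration n)  ≈⟨ turn-iteration≈d₀c^n n ray ⟩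
      d₀ * c ^ n          ≤⟨ least-level≤cd t n n-least ⟩
      c * dist            ∎
      where
      open Target t using (ray; dist)
      open Strategy (geometric (code n ray)) using (turn)

    -- The inhabitant of the index set over which both suprema are taken.
    someTarget : Target
    someTarget = record { ray = Fin.zero ; dist = d₀ ; d₀≤dist = ≤.refl }

    robust : ∀ {r} → b * b ≈ ρ r * (b - 1#) → r ≈ 1# + 2 · ρ r → Robust adviceStrategy r
    robust {r} b²≈ρ[b-1] r≈1+2ρ = bounded-sup someTarget _ λ t → maxBits-lub (λ h → ratio (geometric h) t) λ where
      (s ∷ v) → ≤⁺-trans (ratio≤ s v t (ρ r) λ i first →
        ≤.≤-respʳ-≈ (*-congʳ b²≈ρ[b-1]) (first-turn≤b²d s v t i first)) [ ≤.reflexive (sym r≈1+2ρ) ]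

    consistency : (b-1≉0 : b - 1# ≉ 0#) → ConsistencyAtMost adviceStrategy (1# + 2 · (c / (b - 1#) ⟨ b-1≉0 ⟩))
    consistency b-1≉0 = bounded-sup someTarget _ λ t →
      let n , n-least = level t
      in ratio≤ (firstRay n (Target.ray t)) (offset n) t (c / (b - 1#) ⟨ b-1≉0 ⟩) λ j first →
        ≤.≤-respʳ-≈ (*-congʳ (sym (x/y*y≈x c b-1≉0))) (coded-first-turn≤cd t n n-least j first)

theorem2 :
    (lem : ExcludedMiddle 0ℓ) (ℝ : CompleteOrderedField) →
    let open CompleteOrderedField ℝ in
    (d₀ : Carrier) (d₀>0 : 0# < d₀) →
    let open LineSearch lem ℝ
        open Search d₀ d₀>0 in
    (k : ℕ) → k ℕ.≥ 1 →
    (r : Carrier) → 9 · 1# ≤ r →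
    ∃[ b ] Σ[ b-largest ∈ IsLargestRoot r b ]
    ∃[ c ] (IsNthRoot (2 ℕ.^ (k ℕ.∸ 1)) b c ×
      Σ[ S ∈ AdviceStrategy k ]
        (Robust S r ×
         ConsistencyAtMost S (1# + 2 · (c / (b - 1#) ⟨ proj₁ (proj₁ b-largest) ⟩))))
-- With k = m + 1 the exponent `k ∸ 1` reduces to `m`; the case k = 0 contradicts k ≥ 1.
theorem2 lem ℝ d₀ d₀>0 (suc m) _ r 9≤r =
  let b , b-largest , 1<b , b²≈ρ[b-1] = largest-root 9≤r
      c , c-root = 2^n-root m (proj₁ (1<x⇒0<x 1<b))
      open GeometricSearch.Advice lem ℝ d₀ d₀>0 m b c 1<b c-root
  in b , b-largest , c , c-root , adviceStrategy
       , robust b²≈ρ[b-1] (r≈1+2ρ r) , consistency (proj₁ (proj₁ b-largest))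
  where
  open CompleteOrderedField ℝ
  open OrderedField ℝ
  open Roots lem ℝ
  open Ratio ℝ
  open LargestRoot lem ℝ
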